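{- Let $U,V$ be nonempty sets, $A,A^*$ fuzzy subsets of $U$ and $B$ a fuzzy subset of $V$. Let $\odot$ be a semi-overlap function having $1$ as neutral element and let $\rightarrow$ be its residual implication, $a\rightarrow b=\sup\{w\in[0,1]\mid a\odot w\le b\}$. Then the FMP-solution $B^*$ of the quintuple implication principle exists and is given, for every $v\in V$, by $$B^*(v)=\sup_{u\in U}\big\{A^*(u)\odot[(A^*(u)\rightarrow A(u))\odot(A(u)\rightarrow B(v))]\big\}.$$
   Context: A semi-overlap function is a function $\odot:[0,1]^2\to[0,1]$ such that for all $u,v\in[0,1]$: $u\odot v=v\odot u$; if $uv=0$ then $u\odot v=0$; if $uv=1$ then $u\odot v=1$; $\odot$ is increasing in each variable; and $\odot$ is left-continuous: $u\odot\sup_{i\in I}v_i=\sup_{i\in I}(u\odot v_i)$ for every $u$ and nonempty family $\{v_i\}_{i\in I}\subseteq[0,1]$. $1$ is a neutral element if $1\odot v=v$ for all $v$. A fuzzy subset of $U$ is a function $U\to[0,1]$; fuzzy subsets are ordered pointwise. Given $A,A^*$ on $U$ and $B$ on $V$, the FMP-solution of the quintuple implication principle is the minimum fuzzy subset $B^*$ of $V$ (with respect to the pointwise order) such that for all $u\in U,v\in V$, $$(A(u)\rightarrow B(v))\rightarrow\big((A^*(u)\rightarrow A(u))\rightarrow(A^*(u)\rightarrow B^*(v))\big)=1.$$ -}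

module Defs where

open import Algebra.Core using (Op₂)
open import Data.Empty using (⊥-elim)
open import Data.Product using (Σ-syntax; ∃-syntax; _×_; _,_; proj₁; proj₂)
open import Data.Rational as ℚ using (ℚ; 0ℚ; 1ℚ)
import Data.Rational.Properties as ℚ
open import Data.Sum using (_⊎_; inj₁; inj₂)
open import Level using (Level; Lift; lift; lower; suc; _⊔_)
open import Relation.Binary.PropositionalEquality using (refl)
open import Relation.Nullary using (yes; no)
open import Relation.Nullary.Decidable using (from-yes)
open import Relation.Unary using (Pred; _∈_; _∉_; _⊆_)
open import Relation.Binary using (Rel)

private
  variable
    ℓ i : Level

  -1ℚ : ℚ
  -1ℚ = ℚ.- 1ℚ

-- Real numbers are Dedekind cuts, given by their lower halves: nonempty proper
-- down-closed sets of rationals without greatest element, ordered by inclusion.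
-- A subset of ℚ is a predicate valued in Set ℓ, where ℓ is also the universe of
-- the index sets over which suprema are formed (see ⋁ below).
record ℝ (ℓ : Level) : Set (suc ℓ) where
  field
    cut       : Pred ℚ ℓ
    inhabited : ∃[ q ] q ∈ cut
    proper    : ∃[ q ] q ∉ cut
    down      : ∀ {p q} → p ℚ.< q → q ∈ cut → p ∈ cut
    open-cut  : ∀ {q} → q ∈ cut → ∃[ r ] (q ℚ.< r × r ∈ cut)

open ℝ public

infix 4 _≤ʳ_ _≤_ _≈_

_≤ʳ_ : Rel (ℝ ℓ) ℓ
x ≤ʳ y = cut x ⊆ cut y

fromℚ : ℚ → ℝ ℓ
fromℚ {ℓ} p = record
  { cut       = λ q → Lift ℓ (q ℚ.< p)
  ; inhabited = p ℚ.+ -1ℚ , lift (shift -1ℚ (from-yes (-1ℚ ℚ.<? 0ℚ)))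
  ; proper    = p , λ p<p → ℚ.<-irrefl refl (lower p<p)
  ; down      = λ p<q q<r → lift (ℚ.<-trans p<q (lower q<r))
  ; open-cut  = λ q<p → let r , q<r , r<p = ℚ.<-dense (lower q<p) in r , q<r , lift r<p
  }
  where
  shift : ∀ d → d ℚ.< 0ℚ → p ℚ.+ d ℚ.< p
  shift d d<0 = ℚ.<-respʳ-≡ (ℚ.+-identityʳ p) (ℚ.+-monoʳ-< p d<0)

record 𝕀 (ℓ : Level) : Set (suc ℓ) where
  constructor mk𝕀
  field
    real : ℝ ℓ
    0≤   : fromℚ 0ℚ ≤ʳ real
    ≤1   : real ≤ʳ fromℚ 1ℚ

open 𝕀 public

_≤_ : Rel (𝕀 ℓ) ℓ
x ≤ y = real x ≤ʳ real y

_≈_ : Rel (𝕀 ℓ) ℓ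
x ≈ y = x ≤ y × y ≤ x

fromℚ𝕀 : ∀ q → 0ℚ ℚ.≤ q → q ℚ.≤ 1ℚ → 𝕀 ℓ
fromℚ𝕀 q 0≤q q≤1 = mk𝕀 (fromℚ q)
  (λ r<0 → lift (ℚ.<-≤-trans (lower r<0) 0≤q))
  (λ r<q → lift (ℚ.<-≤-trans (lower r<q) q≤1))

0𝕀 1𝕀 : 𝕀 ℓ
0𝕀 = fromℚ𝕀 0ℚ ℚ.≤-refl (from-yes (0ℚ ℚ.≤? 1ℚ))
1𝕀 = fromℚ𝕀 1ℚ (from-yes (0ℚ ℚ.≤? 1ℚ)) ℚ.≤-refl

infixl 7 _·_

private
  *-mono-<-≥0 : ∀ {r r′ s s′} → 0ℚ ℚ.≤ r → 0ℚ ℚ.≤ s → r ℚ.< r′ → s ℚ.< s′ →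
                r ℚ.* s ℚ.< r′ ℚ.* s′
  *-mono-<-≥0 {r} {r′} {s} {s′} 0≤r 0≤s r<r′ s<s′ =
    ℚ.≤-<-trans (ℚ.*-monoˡ-≤-nonNeg r {{ℚ.nonNegative 0≤r}} (ℚ.<⇒≤ s<s′))
                (ℚ.*-monoˡ-<-pos s′ {{ℚ.positive (ℚ.≤-<-trans 0≤s s<s′)}} r<r′)

-- The ordinary product of nonnegative reals, restricted to [0,1].
_·_ : Op₂ (𝕀 ℓ)
_·_ {ℓ} x y = mk𝕀
  (record
    { cut       = xy
    ; inhabited = -1ℚ , inj₁ (from-yes (-1ℚ ℚ.<? 0ℚ))
    ; proper    = 1ℚ , λ 1∈xy → ℚ.<-irrefl refl (below-1 1∈xy)
    ; down      = λ where
        p<q (inj₁ q<0)                              → inj₁ (ℚ.<-trans p<q q<0)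
        p<q (inj₂ (r , s , 0≤r , 0≤s , r∈ , s∈ , q≤rs)) →
          inj₂ (r , s , 0≤r , 0≤s , r∈ , s∈ , ℚ.<⇒≤ (ℚ.<-≤-trans p<q q≤rs))
    ; open-cut  = open-xy
    })
  (λ q<0 → inj₁ (lower q<0))
  (λ q∈xy → lift (below-1 q∈xy))
  where
  X Y xy : Pred ℚ ℓ
  X = cut (real x)
  Y = cut (real y)
  xy q = q ℚ.< 0ℚ ⊎
         (∃[ r ] ∃[ s ] (0ℚ ℚ.≤ r × 0ℚ ℚ.≤ s × r ∈ X × s ∈ Y × q ℚ.≤ r ℚ.* s))

  below-1 : ∀ {q} → q ∈ xy → q ℚ.< 1ℚ
  below-1 (inj₁ q<0) = ℚ.<-trans q<0 (from-yes (0ℚ ℚ.<? 1ℚ))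
  below-1 (inj₂ (r , s , 0≤r , 0≤s , r∈ , s∈ , q≤rs)) =
    ℚ.≤-<-trans q≤rs (*-mono-<-≥0 0≤r 0≤s (lower (≤1 x r∈)) (lower (≤1 y s∈)))

  open-xy : ∀ {q} → q ∈ xy → ∃[ p ] (q ℚ.< p × p ∈ xy)
  open-xy (inj₁ q<0) = let p , q<p , p<0 = ℚ.<-dense q<0 in p , q<p , inj₁ p<0
  open-xy (inj₂ (r , s , 0≤r , 0≤s , r∈ , s∈ , q≤rs)) =
    let r′ , r<r′ , r′∈ = open-cut (real x) r∈
        s′ , s<s′ , s′∈ = open-cut (real y) s∈
    in r′ ℚ.* s′ , ℚ.≤-<-trans q≤rs (*-mono-<-≥0 0≤r 0≤s r<r′ s<s′) ,
       inj₂ (r′ , s′ , ℚ.≤-trans 0≤r (ℚ.<⇒≤ r<r′) , ℚ.≤-trans 0≤s (ℚ.<⇒≤ s<s′) ,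
             r′∈ , s′∈ , ℚ.≤-refl)

IsSup : {I : Set i} → (I → 𝕀 ℓ) → 𝕀 ℓ → Set (i ⊔ suc ℓ)
IsSup f s = (∀ j → f j ≤ s) × (∀ t → (∀ j → f j ≤ t) → s ≤ t)

-- The supremum of a nonempty family; the first argument witnesses nonemptiness.
⋁ : {I : Set ℓ} → I → (I → 𝕀 ℓ) → 𝕀 ℓ
⋁ {ℓ} {I} j₀ f = mk𝕀
  (record
    { cut       = λ q → ∃[ j ] q ∈ cut (real (f j))
    ; inhabited = let q , q∈ = inhabited (real (f j₀)) in q , j₀ , q∈
    ; proper    = 1ℚ , λ (j , 1∈) → ℚ.<-irrefl refl (lower (≤1 (f j) 1∈))
    ; down      = λ (p<q) (j , q∈) → j , down (real (f j)) p<q q∈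
    ; open-cut  = λ (j , q∈) → let r , q<r , r∈ = open-cut (real (f j)) q∈ in r , q<r , j , r∈
    })
  (λ q<0 → j₀ , 0≤ (f j₀) q<0)
  (λ (j , q∈) → ≤1 (f j) q∈)

⋁-isSup : {I : Set ℓ} (j₀ : I) (f : I → 𝕀 ℓ) → IsSup f (⋁ j₀ f)
⋁-isSup j₀ f = (λ j q∈ → j , q∈) , (λ t f≤t (j , q∈) → f≤t j q∈)

-- Compatibility with _≈_ is not a separate field: it follows from monotonicity.
record IsSemiOverlap (_⊙_ : Op₂ (𝕀 ℓ)) : Set (suc ℓ) where
  field
    comm            : ∀ u v → u ⊙ v ≈ v ⊙ u
    zero            : ∀ u v → u · v ≈ 0𝕀 → u ⊙ v ≈ 0𝕀
    one             : ∀ u v → u · v ≈ 1𝕀 → u ⊙ v ≈ 1𝕀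
    monoˡ           : ∀ u u′ v → u ≤ u′ → (u ⊙ v) ≤ (u′ ⊙ v)
    monoʳ           : ∀ u v v′ → v ≤ v′ → (u ⊙ v) ≤ (u ⊙ v′)
    left-continuous : ∀ u {I : Set ℓ} (j₀ : I) (v : I → 𝕀 ℓ) →
                      u ⊙ ⋁ j₀ v ≈ ⋁ j₀ (λ j → u ⊙ v j)

IsNeutral : Op₂ (𝕀 ℓ) → 𝕀 ℓ → Set (suc ℓ)
IsNeutral _⊙_ e = ∀ v → e ⊙ v ≈ v

-- a ⇒ b = sup { w ∈ [0,1] ∣ a ⊙ w ≤ b }.  This set lives one universe above the
-- index sets of ⋁, so its supremum is specified by IsSup; such a _⇒_ is unique
-- up to _≈_, and it exists by residualImplication-exists.
IsResidualImplication : (_⊙_ _⇒_ : Op₂ (𝕀 ℓ)) → Set (suc ℓ)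
IsResidualImplication {ℓ} _⊙_ _⇒_ =
  ∀ a b → IsSup {I = Σ[ w ∈ 𝕀 ℓ ] (a ⊙ w) ≤ b} proj₁ (a ⇒ b)

-- Every w ∈ [0,1] is the supremum of the rationals below it, so by monotonicity
-- rational w suffice.
residualImplication-exists : (_⊙_ : Op₂ (𝕀 ℓ)) → IsSemiOverlap _⊙_ →
  ∃[ imp ] IsResidualImplication _⊙_ imp
residualImplication-exists {ℓ} _⊙_ so = _⇒_ , λ a b → upper a b , least a b
  where
  open IsSemiOverlap so

  W : 𝕀 ℓ → 𝕀 ℓ → Set ℓ
  W a b = Σ[ q ∈ ℚ ] Σ[ 0≤q ∈ 0ℚ ℚ.≤ q ] Σ[ q≤1 ∈ q ℚ.≤ 1ℚ ] (a ⊙ fromℚ𝕀 q 0≤q q≤1) ≤ b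

  a·0≈0 : ∀ a → a · 0𝕀 ≈ 0𝕀
  a·0≈0 a = (λ where
      (inj₁ q<0) → lift q<0
      (inj₂ (r , s , 0≤r , 0≤s , r∈ , s∈ , _)) → ⊥-elim (ℚ.<-irrefl refl (ℚ.<-≤-trans (lower s∈) 0≤s)))
    , λ q<0 → inj₁ (lower q<0)

  w₀ : ∀ a b → W a b
  w₀ a b = 0ℚ , ℚ.≤-refl , from-yes (0ℚ ℚ.≤? 1ℚ) ,
           λ q∈ → 0≤ b (proj₁ (zero a 0𝕀 (a·0≈0 a)) q∈)

  _⇒_ : Op₂ (𝕀 ℓ)
  a ⇒ b = ⋁ (w₀ a b) (λ (q , 0≤q , q≤1 , _) → fromℚ𝕀 q 0≤q q≤1)

  upper : ∀ a b ((w , _) : Σ[ w ∈ 𝕀 ℓ ] (a ⊙ w) ≤ b) → w ≤ (a ⇒ b)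
  upper a b (w , aw≤b) {q} q∈w with q ℚ.<? 0ℚ
  ... | yes q<0 = 0≤ (a ⇒ b) (lift q<0)
  ... | no  q≮0 =
    let r , q<r , r∈w = open-cut (real w) q∈w
        0≤r = ℚ.≤-trans (ℚ.≮⇒≥ q≮0) (ℚ.<⇒≤ q<r)
        r≤1 = ℚ.<⇒≤ (lower (≤1 w r∈w))
    in (r , 0≤r , r≤1 , λ p∈ → aw≤b (monoʳ a (fromℚ𝕀 r 0≤r r≤1) w
                                       (λ p<r → down (real w) (lower p<r) r∈w) p∈))
       , lift q<r

  least : ∀ a b t → (∀ ((w , _) : Σ[ w ∈ 𝕀 ℓ ] (a ⊙ w) ≤ b) → w ≤ t) → (a ⇒ b) ≤ t
  least a b t bound ((q , 0≤q , q≤1 , aq≤b) , p∈) = bound (fromℚ𝕀 q 0≤q q≤1 , aq≤b) p∈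

FuzzySubset : (ℓ : Level) → Set i → Set (i ⊔ suc ℓ)
FuzzySubset ℓ U = U → 𝕀 ℓ

module _ {u v} {U : Set u} {V : Set v} (_⇒_ : Op₂ (𝕀 ℓ))
         (A A* : FuzzySubset ℓ U) (B : FuzzySubset ℓ V) where

  SatisfiesQIP : FuzzySubset ℓ V → Set (u ⊔ v ⊔ ℓ)
  SatisfiesQIP B* = ∀ x y →
    ((A x ⇒ B y) ⇒ ((A* x ⇒ A x) ⇒ (A* x ⇒ B* y))) ≈ 1𝕀

  IsFMPSolution : FuzzySubset ℓ V → Set (u ⊔ v ⊔ suc ℓ)
  IsFMPSolution B* =
    SatisfiesQIP B* × (∀ C → SatisfiesQIP C → ∀ y → B* y ≤ C y)

-- Residuation a ⊙ w ≤ b ⇔ w ≤ a ⇒ b, together with a ⇒ b ≈ 1 ⇔ a ≤ b (from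
-- neutrality of 1), turns the quintuple implication condition on C into
-- A* x ⊙ ((A* x ⇒ A x) ⊙ (A x ⇒ B y)) ≤ C y for all x, whose least solution is the
-- supremum over x.

module Submission where

open import Defs
open import Level using (Level)
open import Algebra.Core using (Op₂)
open import Data.Product using (_,_; proj₁; proj₂)

private
  variable
    ℓ : Level

≤-trans : (x y z : 𝕀 ℓ) → x ≤ y → y ≤ z → x ≤ z
≤-trans x y z x≤y y≤z q∈x = y≤z (x≤y q∈x)

module Residuation (_⊙_ _⇒_ : Op₂ (𝕀 ℓ))
  (semiOverlap : IsSemiOverlap _⊙_) (residual : IsResidualImplication _⊙_ _⇒_) where

  open IsSemiOverlap semiOverlap

  -- The set defining a ⇒ b is too large for left-continuity, so the supremum is
  -- first replaced by the small one of residualImplication-exists.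
  ⊙-⇒-eval : ∀ a b → (a ⊙ (a ⇒ b)) ≤ b
  ⊙-⇒-eval a b =
    ≤-trans (a ⊙ (a ⇒ b)) (a ⊙ ⋁ j₀ w) b
      -- The small supremum also bounds every `w` with `a ⊙ w ≤ b`, so the least upper bound `a ⇒ b`
      -- lies below it.
      (monoʳ a (a ⇒ b) (⋁ j₀ w)
        (proj₂ (residual a b) (⋁ j₀ w) (proj₁ (proj₂ small a b))))
      (≤-trans (a ⊙ ⋁ j₀ w) (⋁ j₀ (λ j → a ⊙ w j)) b
        (proj₁ (left-continuous a j₀ w))
        (proj₂ (⋁-isSup j₀ (λ j → a ⊙ w j)) b (λ (_ , _ , _ , aq≤b) → aq≤b)))
    where
    small = residualImplication-exists _⊙_ semiOverlap
    -- Membership in the cut of a ⋁ carries an index of the family.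
    j₀ = proj₁ (proj₂ (inhabited (real (proj₁ small a b))))
    w = λ ((q , 0≤q , q≤1 , _) : _) → fromℚ𝕀 q 0≤q q≤1

  residuate : ∀ a w b → (a ⊙ w) ≤ b → w ≤ (a ⇒ b)
  residuate a w b aw≤b = proj₁ (residual a b) (w , λ {_} → aw≤b)

  unresiduate : ∀ a w b → w ≤ (a ⇒ b) → (a ⊙ w) ≤ b
  unresiduate a w b w≤a⇒b = ≤-trans (a ⊙ w) (a ⊙ (a ⇒ b)) b
    (monoʳ a w (a ⇒ b) w≤a⇒b) (⊙-⇒-eval a b)

  module _ (neutral : IsNeutral _⊙_ 1𝕀) where

    -- Residuation at `w = 1𝕀`; `comm` enters because neutrality is stated on the left.
    ⇒≈1-to-≤ : ∀ a b → (a ⇒ b) ≈ 1𝕀 → a ≤ b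
    ⇒≈1-to-≤ a b (_ , 1≤a⇒b) =
      ≤-trans a (1𝕀 ⊙ a) b (proj₂ (neutral a))
        (≤-trans (1𝕀 ⊙ a) (a ⊙ 1𝕀) b (proj₁ (comm 1𝕀 a)) (unresiduate a 1𝕀 b 1≤a⇒b))

    ≤-to-⇒≈1 : ∀ a b → a ≤ b → (a ⇒ b) ≈ 1𝕀
    ≤-to-⇒≈1 a b a≤b = ≤1 (a ⇒ b) , residuate a 1𝕀 b
      (≤-trans (a ⊙ 1𝕀) (1𝕀 ⊙ a) b (proj₂ (comm 1𝕀 a))
        (≤-trans (1𝕀 ⊙ a) a b (proj₁ (neutral a)) a≤b))

    -- The outer implication gives `p ≤ r ⇒ (a ⇒ c)`; residuation then moves `r` and `a` across in
    -- turn, which produces the nesting `a ⊙ (r ⊙ p)`.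
    quintuple-to-≤ : ∀ p r a c → (p ⇒ (r ⇒ (a ⇒ c))) ≈ 1𝕀 → (a ⊙ (r ⊙ p)) ≤ c
    quintuple-to-≤ p r a c valid =
      unresiduate a (r ⊙ p) c
        (unresiduate r p (a ⇒ c) (⇒≈1-to-≤ p (r ⇒ (a ⇒ c)) valid))

    ≤-to-quintuple : ∀ p r a c → (a ⊙ (r ⊙ p)) ≤ c → (p ⇒ (r ⇒ (a ⇒ c))) ≈ 1𝕀
    ≤-to-quintuple p r a c arp≤c =
      ≤-to-⇒≈1 p (r ⇒ (a ⇒ c)) (residuate r p (a ⇒ c) (residuate a (r ⊙ p) c arp≤c))

theorem4p2 : ∀ {ℓ v : Level} (U : Set ℓ) (V : Set v) (u₀ : U) (v₀ : V)
    (A A* : FuzzySubset ℓ U) (B : FuzzySubset ℓ V)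
    (_⊙_ _⇒_ : Op₂ (𝕀 ℓ)) →
    IsSemiOverlap _⊙_ → IsNeutral _⊙_ 1𝕀 → IsResidualImplication _⊙_ _⇒_ →
    IsFMPSolution _⇒_ A A* B
      (λ y → ⋁ u₀ (λ x → A* x ⊙ ((A* x ⇒ A x) ⊙ (A x ⇒ B y))))
theorem4p2 U V u₀ v₀ A A* B _⊙_ _⇒_ semiOverlap neutral residual =
    (λ x y → ≤-to-quintuple neutral (A x ⇒ B y) (A* x ⇒ A x) (A* x) (⋁ u₀ (F y))
      (proj₁ (⋁-isSup u₀ (F y)) x))
  -- Any solution `C` has `C y` above every `F y x`, hence above their least upper bound.
  , (λ C C-satisfies y → proj₂ (⋁-isSup u₀ (F y)) (C y)
      (λ x → quintuple-to-≤ neutral (A x ⇒ B y) (A* x ⇒ A x) (A* x) (C y)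
        (C-satisfies x y)))
  where
  open Residuation _⊙_ _⇒_ semiOverlap residual

  F : V → U → 𝕀 _
  F y x = A* x ⊙ ((A* x ⇒ A x) ⊙ (A x ⇒ B y))
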